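{- For all integers $n,p,m\ge0$, $$\sum_{k=0}^n\binom{k+p}{k}H_{n-k}(m)\,(H_{k+p}-H_p)=\sum_{k=0}^n\binom{k+p}{k}H_{n-k}(m+1).$$ In particular, $\sum_{k=0}^n\binom{k+p}{k}(H_{k+p}-H_p)=\sum_{k=0}^n\binom{k+p}{k}H_{n-k}$ and $\sum_{k=0}^n\binom{k+p}{k}H_{n-k}(H_{k+p}-H_p)=\sum_{k=0}^n\binom{k+p}{k}\left(H_{n-k}^2-H_{n-k}^{(2)}\right)$.
   Context: For integers $m\ge 1$, $n\ge 0$, the multiple harmonic-like numbers are $H_n(m)=\sum_{1\le k_1+k_2+\cdots+k_m\le n}\frac{1}{k_1k_2\cdots k_m}$ (sum over positive integers $k_1,\dots,k_m$), with $H_n(0)=1$ for $n\ge 0$ and $H_0(m)=0$ for $m\ge1$. Equivalently, $\sum_{n\ge0}H_n(m)z^n=\frac{(-\ln(1-z))^m}{1-z}$. $H_n=\sum_{k=1}^n\frac1k$, $H_n^{(2)}=\sum_{k=1}^n\frac1{k^2}$. -}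

module Defs where

open import Data.Nat as ℕ using (ℕ; zero; suc; _≤?_)
open import Data.Nat.Combinatorics using (_C_)
open import Data.Integer using (+_)
open import Data.Rational using (ℚ; 0ℚ; 1ℚ; _+_; _/_)
open import Data.List using (List; []; _∷_; map; foldr; filter; applyUpTo; upTo; cartesianProductWith)
open import Data.Vec as Vec using (Vec; []; _∷_)
open import Relation.Nullary.Decidable using (_×-dec_)

fromℕ : ℕ → ℚ
fromℕ n = + n / 1

-- The value at 0 is a junk value; every use below is at a positive integer.
reciprocal : ℕ → ℚ
reciprocal zero    = 0ℚ
reciprocal (suc k) = + 1 / suc k

∑ : {A : Set} → List A → (A → ℚ) → ℚ
∑ xs f = foldr _+_ 0ℚ (map f xs)

syntax ∑ xs (λ x → e) = ∑[ x ∈ xs ] e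

[0⋯_] : ℕ → List ℕ
[0⋯ n ] = upTo (suc n)

[1⋯_] : ℕ → List ℕ
[1⋯ n ] = applyUpTo suc n

binomial : ℕ → ℕ → ℚ
binomial n k = fromℕ (n C k)

harmonic : ℕ → ℚ
harmonic n = ∑[ k ∈ [1⋯ n ] ] reciprocal k

-- harmonic⁽ r ⁾ n is H_n^{(r)}.
harmonic⁽_⁾ : ℕ → ℕ → ℚ
harmonic⁽ r ⁾ n = ∑[ k ∈ [1⋯ n ] ] reciprocal (k ℕ.^ r)

tuples : {A : Set} → List A → (m : ℕ) → List (Vec A m)
tuples xs zero    = [] ∷ []
tuples xs (suc m) = cartesianProductWith _∷_ xs (tuples xs m)

-- The tuples of positive integers with 1 ≤ k₁ + ⋯ + kₘ ≤ n.  It is enough to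
-- search {1,…,n}ᵐ, since positive kᵢ with sum at most n are each at most n.
indexTuples : (n m : ℕ) → List (Vec ℕ m)
indexTuples n m =
  filter (λ ks → (1 ≤? Vec.sum ks) ×-dec (Vec.sum ks ≤? n)) (tuples [1⋯ n ] m)

-- multiHarmonic n m is H_n(m).  The case m = 0 is a separate convention: the
-- empty tuple has sum 0 and so does not satisfy the condition 1 ≤ sum.
multiHarmonic : (n m : ℕ) → ℚ
multiHarmonic n zero        = 1ℚ
multiHarmonic n m@(suc _)   = ∑[ ks ∈ indexTuples n m ] reciprocal (Vec.foldr′ ℕ._*_ 1 ks)

{-# OPTIONS --safe #-}

-- In terms of generating functions, H(m + 1) is the product of H(m) with
-- −ln(1 − z) = ∑ zᵏ / k, and ∑ C(k+p,k) (H_{k+p} − H_p) zᵏ is the product of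
-- ∑ C(k+p,k) zᵏ with the same series (by Pascal's rule and absorption).
-- The identity is then associativity of the Cauchy product.  The special cases
-- use H_n(1) = H_n and H_n(2) = H_n² − H_n^{(2)}; the latter holds because
-- z d/dz is a derivation, so that the coefficient of zⁿ⁺¹ in ln²(1 − z)
-- is 2 H_n / (n + 1).
module Submission where

open import Data.Bool using (Bool; true; false; if_then_else_; _∧_)
open import Data.Bool.Properties using (if-eta)
import Data.Integer as ℤ
import Data.Integer.Properties as ℤ
open import Data.List using (List; []; _∷_; _++_; map; filter; applyUpTo; upTo; cartesianProductWith)
open import Data.List.Properties using (applyUpTo-∷ʳ)
open import Data.Nat as ℕ using (ℕ; zero; suc; _∸_; _≤ᵇ_; _≤_; z≤n; s≤s)
open import Data.Nat.Combinatorics using (_C_; nC1≡n; nCn≡1; nCk+nC[k+1]≡[n+1]C[k+1]; k>n⇒nCk≡0)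
import Data.Nat.Properties as ℕ
import Data.Nat.Tactic.RingSolver as ℕ
open import Data.Product using (_×_; _,_)
open import Data.Rational using (ℚ; 0ℚ; 1ℚ; _+_; _*_; _-_; fromℚᵘ)
open import Data.Rational.Properties
open import Data.Rational.Solver using (module +-*-Solver)
open import Data.Rational.Unnormalised as ℚᵘ using (mkℚᵘ; *≡*)
import Data.Rational.Unnormalised.Properties as ℚᵘ
open import Data.Vec as Vec using (Vec; []; _∷_)
open import Function using (_∘_; const)
open import Relation.Binary.PropositionalEquality using (_≡_; refl; sym; trans; cong; cong₂; module ≡-Reasoning)
open import Relation.Nullary using (does)
open import Relation.Unary using (Decidable)
open import Defs

open ≡-Reasoning
open +-*-Solver

-- Embedding of the naturals and reciprocals

-- `fromℕ` and positive `reciprocal`s are by definition `fromℚᵘ` of explicit fractions, so this and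
-- its multiplicative twin reduce their arithmetic to integer numerators and denominators.
fromℚᵘ-homo-+ : ∀ p q → fromℚᵘ (p ℚᵘ.+ q) ≡ fromℚᵘ p + fromℚᵘ q
fromℚᵘ-homo-+ p q = toℚᵘ-injective (ℚᵘ.≃-trans (toℚᵘ-fromℚᵘ (p ℚᵘ.+ q)) (ℚᵘ.≃-sym
  (ℚᵘ.≃-trans (toℚᵘ-homo-+ (fromℚᵘ p) (fromℚᵘ q))
              (ℚᵘ.+-cong (toℚᵘ-fromℚᵘ p) (toℚᵘ-fromℚᵘ q)))))

fromℚᵘ-homo-* : ∀ p q → fromℚᵘ (p ℚᵘ.* q) ≡ fromℚᵘ p * fromℚᵘ q
fromℚᵘ-homo-* p q = toℚᵘ-injective (ℚᵘ.≃-trans (toℚᵘ-fromℚᵘ (p ℚᵘ.* q)) (ℚᵘ.≃-sym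
  (ℚᵘ.≃-trans (toℚᵘ-homo-* (fromℚᵘ p) (fromℚᵘ q))
              (ℚᵘ.*-cong (toℚᵘ-fromℚᵘ p) (toℚᵘ-fromℚᵘ q)))))

fromℕ-homo-+ : ∀ m n → fromℕ (m ℕ.+ n) ≡ fromℕ m + fromℕ n
fromℕ-homo-+ m n = trans
  (cong (λ i → fromℚᵘ (mkℚᵘ i 0))
    (trans (ℤ.pos-+ m n) (sym (cong₂ ℤ._+_ (ℤ.*-identityʳ (ℤ.+ m)) (ℤ.*-identityʳ (ℤ.+ n))))))
  (fromℚᵘ-homo-+ (mkℚᵘ (ℤ.+ m) 0) (mkℚᵘ (ℤ.+ n) 0))

fromℕ-homo-* : ∀ m n → fromℕ (m ℕ.* n) ≡ fromℕ m * fromℕ n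
fromℕ-homo-* m n = trans
  (cong (λ i → fromℚᵘ (mkℚᵘ i 0)) (ℤ.pos-* m n))
  (fromℚᵘ-homo-* (mkℚᵘ (ℤ.+ m) 0) (mkℚᵘ (ℤ.+ n) 0))

-- The junk value `reciprocal 0 = 0ℚ` keeps this true at zero, so weights of tuples factor without
-- tracking positivity of the entries.
reciprocal-* : ∀ m n → reciprocal (m ℕ.* n) ≡ reciprocal m * reciprocal n
reciprocal-* zero    n       = sym (*-zeroˡ (reciprocal n))
reciprocal-* (suc m) zero    = trans (cong reciprocal (ℕ.*-zeroʳ m)) (sym (*-zeroʳ (reciprocal (suc m))))
reciprocal-* (suc m) (suc n) = fromℚᵘ-homo-* (mkℚᵘ (ℤ.+ 1) m) (mkℚᵘ (ℤ.+ 1) n)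

reciprocal-inverse : ∀ n → fromℕ (suc n) * reciprocal (suc n) ≡ 1ℚ
reciprocal-inverse n = trans
  (sym (fromℚᵘ-homo-* (mkℚᵘ (ℤ.+ suc n) 0) (mkℚᵘ (ℤ.+ 1) n)))
  (fromℚᵘ-cong {mkℚᵘ (ℤ.+ suc n) 0 ℚᵘ.* mkℚᵘ (ℤ.+ 1) n} {mkℚᵘ (ℤ.+ 1) 0}
    (*≡* (trans (ℤ.*-identityʳ _) (trans (ℤ.*-identityʳ _)
      (sym (trans (ℤ.*-identityˡ _) (cong (λ k → ℤ.+ suc k) (ℕ.+-identityʳ n))))))))

-- Finite sums

∑-cong : {A : Set} (xs : List A) {f g : A → ℚ} → (∀ x → f x ≡ g x) → ∑ xs f ≡ ∑ xs g
∑-cong []       f≗g = refl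
∑-cong (x ∷ xs) f≗g = cong₂ _+_ (f≗g x) (∑-cong xs f≗g)

∑-zero : {A : Set} (xs : List A) → ∑ xs (const 0ℚ) ≡ 0ℚ
∑-zero []       = refl
∑-zero (x ∷ xs) = trans (+-identityˡ _) (∑-zero xs)

∑-*ˡ : {A : Set} (c : ℚ) (xs : List A) (f : A → ℚ) → ∑[ x ∈ xs ] (c * f x) ≡ c * ∑ xs f
∑-*ˡ c []       f = sym (*-zeroʳ c)
∑-*ˡ c (x ∷ xs) f = trans (cong ((c * f x) +_) (∑-*ˡ c xs f)) (sym (*-distribˡ-+ c (f x) (∑ xs f)))

∑-++ : {A : Set} (xs ys : List A) (f : A → ℚ) → ∑ (xs ++ ys) f ≡ ∑ xs f + ∑ ys f
∑-++ []       ys f = sym (+-identityˡ _)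
∑-++ (x ∷ xs) ys f = trans (cong (f x +_) (∑-++ xs ys f)) (sym (+-assoc (f x) _ _))

∑-map : {A B : Set} (g : A → B) (xs : List A) (f : B → ℚ) → ∑ (map g xs) f ≡ ∑ xs (f ∘ g)
∑-map g []       f = refl
∑-map g (x ∷ xs) f = cong (f (g x) +_) (∑-map g xs f)

∑-cartesianProductWith : {A B D : Set} (_∙_ : A → B → D) (xs : List A) (ys : List B) (f : D → ℚ) →
  ∑ (cartesianProductWith _∙_ xs ys) f ≡ ∑[ x ∈ xs ] ∑[ y ∈ ys ] f (x ∙ y)
∑-cartesianProductWith _∙_ []       ys f = refl
∑-cartesianProductWith _∙_ (x ∷ xs) ys f = trans
  (∑-++ (map (x ∙_) ys) _ f)
  (cong₂ _+_ (∑-map (x ∙_) ys f) (∑-cartesianProductWith _∙_ xs ys f))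

∑-filter : {A : Set} {P : A → Set} (P? : Decidable P) (xs : List A) (f : A → ℚ) →
  ∑ (filter P? xs) f ≡ ∑[ x ∈ xs ] (if does (P? x) then f x else 0ℚ)
∑-filter P? []       f = refl
∑-filter P? (x ∷ xs) f with does (P? x)
... | false = trans (∑-filter P? xs f) (sym (+-identityˡ _))
... | true  = cong (f x +_) (∑-filter P? xs f)

∑-applyUpTo : {A : Set} (g : ℕ → A) (n : ℕ) (f : A → ℚ) → ∑ (applyUpTo g n) f ≡ ∑ (upTo n) (f ∘ g)
∑-applyUpTo g zero    f = refl
∑-applyUpTo g (suc n) f = cong (f (g 0) +_)
  -- The tail of `upTo (suc n)` is `applyUpTo suc n`, so both tails are brought back to `upTo n`.
  (trans (∑-applyUpTo (g ∘ suc) n f) (sym (∑-applyUpTo suc n (f ∘ g))))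

-- Cauchy products of sequences

infixl 7 _⋆_

-- Splitting off the term with `f 0` avoids truncated subtraction and makes the algebraic laws
-- structural inductions in which `f` is replaced by `f ∘ suc`.
_⋆_ : (ℕ → ℚ) → (ℕ → ℚ) → ℕ → ℚ
(f ⋆ g) zero    = f 0 * g 0
(f ⋆ g) (suc n) = f 0 * g (suc n) + (f ∘ suc ⋆ g) n

∑≡⋆ : ∀ f g n → ∑[ k ∈ [0⋯ n ] ] (f k * g (n ∸ k)) ≡ (f ⋆ g) n
∑≡⋆ f g zero    = +-identityʳ _
∑≡⋆ f g (suc n) = cong ((f 0 * g (suc n)) +_)
  (trans (∑-applyUpTo suc (suc n) (λ k → f k * g (suc n ∸ k))) (∑≡⋆ (f ∘ suc) g n))

1+m≤ᵇ1+n : ∀ m n → (suc m ≤ᵇ suc n) ≡ (m ≤ᵇ n)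
1+m≤ᵇ1+n zero    n = refl
1+m≤ᵇ1+n (suc m) n = refl

-- The guard removes the indices between `n` and `N`; this is what lets tuple entries range up to a
-- fixed `N` while the bound `n` shrinks.
∑-truncated≡⋆ : ∀ f g {n N} → n ≤ N →
  ∑[ k ∈ [0⋯ N ] ] (if k ≤ᵇ n then f k * g (n ∸ k) else 0ℚ) ≡ (f ⋆ g) n
∑-truncated≡⋆ f g {zero} {N} z≤n = trans
  (cong ((f 0 * g 0) +_)
    (trans (∑-applyUpTo suc N (λ k → if k ≤ᵇ 0 then f k * g (0 ∸ k) else 0ℚ)) (∑-zero (upTo N))))
  (+-identityʳ (f 0 * g 0))
∑-truncated≡⋆ f g {suc n} {suc N} (s≤s n≤N) = cong ((f 0 * g (suc n)) +_) (begin
  ∑ (applyUpTo suc (suc N)) (λ k → if k ≤ᵇ suc n then f k * g (suc n ∸ k) else 0ℚ)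
    ≡⟨ ∑-applyUpTo suc (suc N) (λ k → if k ≤ᵇ suc n then f k * g (suc n ∸ k) else 0ℚ) ⟩
  ∑[ k ∈ [0⋯ N ] ] (if suc k ≤ᵇ suc n then f (suc k) * g (n ∸ k) else 0ℚ)
    ≡⟨ ∑-cong [0⋯ N ] (λ k → cong (if_then f (suc k) * g (n ∸ k) else 0ℚ) (1+m≤ᵇ1+n k n)) ⟩
  ∑[ k ∈ [0⋯ N ] ] (if k ≤ᵇ n then f (suc k) * g (n ∸ k) else 0ℚ)
    ≡⟨ ∑-truncated≡⋆ (f ∘ suc) g n≤N ⟩
  (f ∘ suc ⋆ g) n ∎)

⋆-cong : ∀ {f f′ g g′} → (∀ n → f n ≡ f′ n) → (∀ n → g n ≡ g′ n) → ∀ n → (f ⋆ g) n ≡ (f′ ⋆ g′) n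
⋆-cong f≗f′ g≗g′ zero    = cong₂ _*_ (f≗f′ 0) (g≗g′ 0)
⋆-cong f≗f′ g≗g′ (suc n) =
  cong₂ _+_ (cong₂ _*_ (f≗f′ 0) (g≗g′ (suc n))) (⋆-cong (f≗f′ ∘ suc) g≗g′ n)

⋆-congˡ : ∀ f {g g′} → (∀ n → g n ≡ g′ n) → ∀ n → (f ⋆ g) n ≡ (f ⋆ g′) n
⋆-congˡ f = ⋆-cong {f} (λ _ → refl)

⋆-congʳ : ∀ {f f′} g → (∀ n → f n ≡ f′ n) → ∀ n → (f ⋆ g) n ≡ (f′ ⋆ g) n
⋆-congʳ g f≗f′ = ⋆-cong f≗f′ (λ _ → refl)

-- The mirror image of the defining recursion: the term with `g 0` is split off instead. It yields
-- commutativity, and gives access to recurrences satisfied by the second factor.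
⋆-sucʳ : ∀ f g n → (f ⋆ g) (suc n) ≡ f (suc n) * g 0 + (f ⋆ g ∘ suc) n
⋆-sucʳ f g zero    = +-comm (f 0 * g 1) (f 1 * g 0)
⋆-sucʳ f g (suc n) = trans
  (cong ((f 0 * g (suc (suc n))) +_) (⋆-sucʳ (f ∘ suc) g n))
  (solve 3 (λ a b c → a :+ (b :+ c) := b :+ (a :+ c)) refl
    (f 0 * g (suc (suc n))) (f (suc (suc n)) * g 0) ((f ∘ suc ⋆ g ∘ suc) n))

⋆-comm : ∀ f g n → (f ⋆ g) n ≡ (g ⋆ f) n
⋆-comm f g zero    = *-comm (f 0) (g 0)
⋆-comm f g (suc n) = trans
  (cong₂ _+_ (*-comm (f 0) (g (suc n))) (⋆-comm (f ∘ suc) g n))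
  (sym (⋆-sucʳ g f n))

⋆-distribʳ-+ : ∀ f g h n → ((λ k → f k + g k) ⋆ h) n ≡ (f ⋆ h) n + (g ⋆ h) n
⋆-distribʳ-+ f g h zero    = *-distribʳ-+ (h 0) (f 0) (g 0)
⋆-distribʳ-+ f g h (suc n) = trans
  (cong (((f 0 + g 0) * h (suc n)) +_) (⋆-distribʳ-+ (f ∘ suc) (g ∘ suc) h n))
  (solve 5 (λ a b c d e → (a :+ b) :* c :+ (d :+ e) := (a :* c :+ d) :+ (b :* c :+ e)) refl
    (f 0) (g 0) (h (suc n)) ((f ∘ suc ⋆ h) n) ((g ∘ suc ⋆ h) n))

⋆-distribˡ-+ : ∀ f g h n → (f ⋆ (λ k → g k + h k)) n ≡ (f ⋆ g) n + (f ⋆ h) n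
⋆-distribˡ-+ f g h n = begin
  (f ⋆ (λ k → g k + h k)) n  ≡⟨ ⋆-comm f (λ k → g k + h k) n ⟩
  ((λ k → g k + h k) ⋆ f) n  ≡⟨ ⋆-distribʳ-+ g h f n ⟩
  (g ⋆ f) n + (h ⋆ f) n      ≡⟨ cong₂ _+_ (⋆-comm g f n) (⋆-comm h f n) ⟩
  (f ⋆ g) n + (f ⋆ h) n      ∎

⋆-scaleˡ : ∀ c f g n → ((λ k → c * f k) ⋆ g) n ≡ c * (f ⋆ g) n
⋆-scaleˡ c f g zero    = *-assoc c (f 0) (g 0)
⋆-scaleˡ c f g (suc n) = trans
  (cong₂ _+_ (*-assoc c (f 0) (g (suc n))) (⋆-scaleˡ c (f ∘ suc) g n))
  (sym (*-distribˡ-+ c _ _))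

-- By definition `(f ⋆ g) ∘ suc` is a multiple of `g ∘ suc` plus `f ∘ suc ⋆ g`; distributing over
-- `h` leaves the induction hypothesis for `f ∘ suc`.
⋆-assoc : ∀ f g h n → ((f ⋆ g) ⋆ h) n ≡ (f ⋆ (g ⋆ h)) n
⋆-assoc f g h zero    = *-assoc (f 0) (g 0) (h 0)
⋆-assoc f g h (suc n) = begin
  f 0 * g 0 * h (suc n) + ((λ k → f 0 * g (suc k) + (f ∘ suc ⋆ g) k) ⋆ h) n
    ≡⟨ cong ((f 0 * g 0 * h (suc n)) +_) (⋆-distribʳ-+ (λ k → f 0 * g (suc k)) (f ∘ suc ⋆ g) h n) ⟩
  f 0 * g 0 * h (suc n) + (((λ k → f 0 * g (suc k)) ⋆ h) n + ((f ∘ suc ⋆ g) ⋆ h) n)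
    ≡⟨ cong ((f 0 * g 0 * h (suc n)) +_)
         (cong₂ _+_ (⋆-scaleˡ (f 0) (g ∘ suc) h n) (⋆-assoc (f ∘ suc) g h n)) ⟩
  f 0 * g 0 * h (suc n) + (f 0 * (g ∘ suc ⋆ h) n + (f ∘ suc ⋆ (g ⋆ h)) n)
    ≡⟨ solve 5 (λ a b c d e → a :* b :* c :+ (a :* d :+ e) := a :* (b :* c :+ d) :+ e) refl
         (f 0) (g 0) (h (suc n)) ((g ∘ suc ⋆ h) n) ((f ∘ suc ⋆ (g ⋆ h)) n) ⟩
  f 0 * (g 0 * h (suc n) + (g ∘ suc ⋆ h) n) + (f ∘ suc ⋆ (g ⋆ h)) n ∎

-- The operator z d/dz on generating functions.
θ : (ℕ → ℚ) → ℕ → ℚ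
θ f n = fromℕ n * f n

-- Coefficient form of `θ (z F) = z F + z θ F`.
θ-suc : ∀ f n → θ f (suc n) ≡ f (suc n) + θ (f ∘ suc) n
θ-suc f n = begin
  fromℕ (suc n) * f (suc n)      ≡⟨ cong (_* f (suc n)) (fromℕ-homo-+ 1 n) ⟩
  (1ℚ + fromℕ n) * f (suc n)     ≡⟨ solve 2 (λ a b → (con 1ℚ :+ a) :* b := b :+ a :* b) refl (fromℕ n) (f (suc n)) ⟩
  f (suc n) + fromℕ n * f (suc n) ∎

θ-⋆ : ∀ f g n → θ (f ⋆ g) n ≡ (θ f ⋆ g) n + (f ⋆ θ g) n
θ-⋆ f g zero    =
  solve 2 (λ a b → con 0ℚ :* (a :* b) := con 0ℚ :* a :* b :+ a :* (con 0ℚ :* b)) refl (f 0) (g 0)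
θ-⋆ f g (suc n) = begin
  N * (f 0 * g (suc n) + (f ∘ suc ⋆ g) n)
    ≡⟨ *-distribˡ-+ N _ _ ⟩
  N * (f 0 * g (suc n)) + N * (f ∘ suc ⋆ g) n
    ≡⟨ cong ((N * (f 0 * g (suc n))) +_) (begin
       N * (f ∘ suc ⋆ g) n
         ≡⟨ cong (_* (f ∘ suc ⋆ g) n) (fromℕ-homo-+ 1 n) ⟩
       (1ℚ + fromℕ n) * (f ∘ suc ⋆ g) n
         ≡⟨ solve 2 (λ a b → (con 1ℚ :+ a) :* b := b :+ a :* b) refl (fromℕ n) ((f ∘ suc ⋆ g) n) ⟩
       (f ∘ suc ⋆ g) n + θ (f ∘ suc ⋆ g) n
         ≡⟨ cong ((f ∘ suc ⋆ g) n +_) (θ-⋆ (f ∘ suc) g n) ⟩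
       (f ∘ suc ⋆ g) n + ((θ (f ∘ suc) ⋆ g) n + (f ∘ suc ⋆ θ g) n)
         ≡⟨ +-assoc ((f ∘ suc ⋆ g) n) _ _ ⟨
       ((f ∘ suc ⋆ g) n + (θ (f ∘ suc) ⋆ g) n) + (f ∘ suc ⋆ θ g) n
         ≡⟨ cong (_+ (f ∘ suc ⋆ θ g) n) (⋆-distribʳ-+ (f ∘ suc) (θ (f ∘ suc)) g n) ⟨
       ((λ k → f (suc k) + θ (f ∘ suc) k) ⋆ g) n + (f ∘ suc ⋆ θ g) n
         ≡⟨ cong (_+ (f ∘ suc ⋆ θ g) n) (⋆-congʳ g (θ-suc f) n) ⟨
       (θ f ∘ suc ⋆ g) n + (f ∘ suc ⋆ θ g) n ∎) ⟩
  N * (f 0 * g (suc n)) + ((θ f ∘ suc ⋆ g) n + (f ∘ suc ⋆ θ g) n)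
    -- The summand with `con 0ℚ` is the head term of `θ f ⋆ g`, which vanishes because `θ f 0` is
    -- zero.
    ≡⟨ solve 5 (λ a b c d e → a :* (b :* c) :+ (d :+ e)
                            := (con 0ℚ :* b :* c :+ d) :+ (b :* (a :* c) :+ e)) refl
         N (f 0) (g (suc n)) ((θ f ∘ suc ⋆ g) n) ((f ∘ suc ⋆ θ g) n) ⟩
  (θ f ⋆ g) (suc n) + (f ⋆ θ g) (suc n) ∎
  where N = fromℕ (suc n)

-- Harmonic numbers

harmonic≡⋆ : ∀ n → harmonic n ≡ (reciprocal ⋆ const 1ℚ) n
harmonic≡⋆ n = begin
  -- The index may start at 0 because `reciprocal 0` is `0ℚ`.
  harmonic n                           ≡⟨ +-identityˡ (harmonic n) ⟨
  ∑ [0⋯ n ] reciprocal                 ≡⟨ ∑-cong [0⋯ n ] (λ k → *-identityʳ (reciprocal k)) ⟨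
  ∑[ k ∈ [0⋯ n ] ] (reciprocal k * 1ℚ) ≡⟨ ∑≡⋆ reciprocal (const 1ℚ) n ⟩
  (reciprocal ⋆ const 1ℚ) n            ∎

∑[1⋯]-suc : ∀ f n → ∑ [1⋯ suc n ] f ≡ ∑ [1⋯ n ] f + f (suc n)
∑[1⋯]-suc f n = begin
  ∑ [1⋯ suc n ] f                ≡⟨ cong (λ ks → ∑ ks f) (applyUpTo-∷ʳ suc n) ⟨
  ∑ ([1⋯ n ] ++ suc n ∷ []) f    ≡⟨ ∑-++ [1⋯ n ] (suc n ∷ []) f ⟩
  ∑ [1⋯ n ] f + (f (suc n) + 0ℚ) ≡⟨ cong (∑ [1⋯ n ] f +_) (+-identityʳ (f (suc n))) ⟩
  ∑ [1⋯ n ] f + f (suc n)        ∎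

harmonic-suc : ∀ n → harmonic (suc n) ≡ harmonic n + reciprocal (suc n)
harmonic-suc = ∑[1⋯]-suc reciprocal

-- `θ reciprocal` is the sequence 0, 1, 1, 1, ..., that is z/(1 - z), so the product gives partial
-- sums shifted by one.
⋆-θreciprocal : ∀ n → (reciprocal ⋆ θ reciprocal) (suc n) ≡ harmonic n
⋆-θreciprocal n = begin
  (reciprocal ⋆ θ reciprocal) (suc n)
    ≡⟨ ⋆-sucʳ reciprocal (θ reciprocal) n ⟩
  reciprocal (suc n) * 0ℚ + (reciprocal ⋆ θ reciprocal ∘ suc) n
    ≡⟨ cong₂ _+_ (*-zeroʳ (reciprocal (suc n))) (⋆-congˡ reciprocal reciprocal-inverse n) ⟩
  0ℚ + (reciprocal ⋆ const 1ℚ) n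
    ≡⟨ +-identityˡ _ ⟩
  (reciprocal ⋆ const 1ℚ) n
    ≡⟨ harmonic≡⋆ n ⟨
  harmonic n ∎

-- After multiplication by `n + 1`, the product rule gives two summands that agree by commutativity,
-- each equal to `harmonic n`.
reciprocal-⋆-square : ∀ n →
  (reciprocal ⋆ reciprocal) (suc n) ≡ reciprocal (suc n) * (harmonic n + harmonic n)
reciprocal-⋆-square n = begin
  x                     ≡⟨ *-identityˡ x ⟨
  1ℚ * x                ≡⟨ cong (_* x) (reciprocal-inverse n) ⟨
  N * r * x             ≡⟨ solve 3 (λ N r x → N :* r :* x := r :* (N :* x)) refl N r x ⟩
  r * (N * x)           ≡⟨ cong (r *_) (θ-⋆ reciprocal reciprocal (suc n)) ⟩
  r * ((θ reciprocal ⋆ reciprocal) (suc n) + (reciprocal ⋆ θ reciprocal) (suc n))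
    ≡⟨ cong (λ y → r * (y + (reciprocal ⋆ θ reciprocal) (suc n))) (⋆-comm (θ reciprocal) reciprocal (suc n)) ⟩
  r * ((reciprocal ⋆ θ reciprocal) (suc n) + (reciprocal ⋆ θ reciprocal) (suc n))
    ≡⟨ cong (λ y → r * (y + y)) (⋆-θreciprocal n) ⟩
  r * (harmonic n + harmonic n) ∎
  where
  N r x : ℚ
  N = fromℕ (suc n)
  r = reciprocal (suc n)
  x = (reciprocal ⋆ reciprocal) (suc n)

-- Induction on `n` by comparing increments: on the left it is `(reciprocal ⋆ reciprocal) (suc n)`,
-- on the right `(h + r)² − h² − r² = 2hr`.
reciprocal-⋆-harmonic : ∀ n →
  (reciprocal ⋆ harmonic) n ≡ harmonic n * harmonic n - harmonic⁽ 2 ⁾ n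
reciprocal-⋆-harmonic zero    = refl
reciprocal-⋆-harmonic (suc n) = begin
  (reciprocal ⋆ harmonic) (suc n)
    ≡⟨ ⋆-sucʳ reciprocal harmonic n ⟩
  r * 0ℚ + (reciprocal ⋆ harmonic ∘ suc) n
    ≡⟨ cong ((r * 0ℚ) +_) (⋆-congˡ reciprocal harmonic-suc n) ⟩
  r * 0ℚ + (reciprocal ⋆ (λ k → harmonic k + reciprocal (suc k))) n
    ≡⟨ cong ((r * 0ℚ) +_) (⋆-distribˡ-+ reciprocal harmonic (reciprocal ∘ suc) n) ⟩
  r * 0ℚ + ((reciprocal ⋆ harmonic) n + (reciprocal ⋆ reciprocal ∘ suc) n)
    ≡⟨ solve 3 (λ a b c → a :+ (b :+ c) := b :+ (a :+ c)) refl
         (r * 0ℚ) ((reciprocal ⋆ harmonic) n) ((reciprocal ⋆ reciprocal ∘ suc) n) ⟩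
  (reciprocal ⋆ harmonic) n + (r * 0ℚ + (reciprocal ⋆ reciprocal ∘ suc) n)
    ≡⟨ cong ((reciprocal ⋆ harmonic) n +_) (⋆-sucʳ reciprocal reciprocal n) ⟨
  (reciprocal ⋆ harmonic) n + (reciprocal ⋆ reciprocal) (suc n)
    ≡⟨ cong₂ _+_ (reciprocal-⋆-harmonic n) (reciprocal-⋆-square n) ⟩
  h * h - h₂ + r * (h + h)
    ≡⟨ solve 3 (λ h h₂ r → h :* h :- h₂ :+ r :* (h :+ h)
                         := (h :+ r) :* (h :+ r) :- (h₂ :+ r :* r)) refl h h₂ r ⟩
  (h + r) * (h + r) - (h₂ + r * r)
    ≡⟨ cong₂ _-_ (cong₂ _*_ (harmonic-suc n) (harmonic-suc n))
         (trans (∑[1⋯]-suc (λ k → reciprocal (k ℕ.^ 2)) n)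
           (cong (h₂ +_) (trans (cong (λ k → reciprocal (suc n ℕ.* k)) (ℕ.*-identityʳ (suc n)))
                                (reciprocal-* (suc n) (suc n))))) ⟨
  harmonic (suc n) * harmonic (suc n) - harmonic⁽ 2 ⁾ (suc n) ∎
  where
  h h₂ r : ℚ
  h  = harmonic n
  h₂ = harmonic⁽ 2 ⁾ n
  r  = reciprocal (suc n)

-- Multiple harmonic-like numbers

-- The coefficients of (-ln(1 - z))ᵐ / (1 - z).
iteratedHarmonic : ℕ → ℕ → ℚ
iteratedHarmonic zero    = const 1ℚ
iteratedHarmonic (suc m) = reciprocal ⋆ iteratedHarmonic m

weight : ∀ {m} → Vec ℕ m → ℚ
weight ks = reciprocal (Vec.foldr′ ℕ._*_ 1 ks)

-- Separating the range N of the entries from the bound n on their sum allows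
-- induction on the number of entries.
truncatedSum : (N n m : ℕ) → ℚ
truncatedSum N n m = ∑[ ks ∈ tuples [1⋯ N ] m ] (if Vec.sum ks ≤ᵇ n then weight ks else 0ℚ)

-- For `k > n` the difference truncates to 0 and the second test may succeed, but then the first one
-- fails.
k+s≤ᵇn : ∀ k s n → (k ℕ.+ s ≤ᵇ n) ≡ (k ≤ᵇ n) ∧ (s ≤ᵇ n ∸ k)
k+s≤ᵇn zero    s n       = refl
k+s≤ᵇn (suc k) s zero    = refl
k+s≤ᵇn (suc k) s (suc n) = begin
  (suc (k ℕ.+ s) ≤ᵇ suc n)         ≡⟨ 1+m≤ᵇ1+n (k ℕ.+ s) n ⟩
  (k ℕ.+ s ≤ᵇ n)                   ≡⟨ k+s≤ᵇn k s n ⟩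
  (k ≤ᵇ n) ∧ (s ≤ᵇ n ∸ k)          ≡⟨ cong (_∧ (s ≤ᵇ n ∸ k)) (1+m≤ᵇ1+n k n) ⟨
  (suc k ≤ᵇ suc n) ∧ (s ≤ᵇ n ∸ k)  ∎

∑-guarded : {A : Set} (b : Bool) (c : ℚ) (xs : List A) (p : A → Bool) (f : A → ℚ) →
  ∑[ x ∈ xs ] (if b ∧ p x then c * f x else 0ℚ)
    ≡ (if b then c * ∑[ x ∈ xs ] (if p x then f x else 0ℚ) else 0ℚ)
∑-guarded false c xs p f = ∑-zero xs
∑-guarded true  c xs p f = trans
  (∑-cong xs (λ x → pull (p x) (f x)))
  (∑-*ˡ c xs (λ x → if p x then f x else 0ℚ))
  where
  pull : ∀ b y → (if b then c * y else 0ℚ) ≡ c * (if b then y else 0ℚ)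
  pull true  y = refl
  pull false y = sym (*-zeroʳ c)

truncatedSum-head : ∀ N n m k →
  ∑[ ks ∈ tuples [1⋯ N ] m ] (if k ℕ.+ Vec.sum ks ≤ᵇ n then weight (k ∷ ks) else 0ℚ)
    ≡ (if k ≤ᵇ n then reciprocal k * truncatedSum N (n ∸ k) m else 0ℚ)
truncatedSum-head N n m k = trans
  (∑-cong (tuples [1⋯ N ] m) (λ ks → cong₂ (λ b x → if b then x else 0ℚ)
    (k+s≤ᵇn k (Vec.sum ks) n) (reciprocal-* k (Vec.foldr′ ℕ._*_ 1 ks))))
  (∑-guarded (k ≤ᵇ n) (reciprocal k) (tuples [1⋯ N ] m) (λ ks → Vec.sum ks ≤ᵇ n ∸ k) weight)

truncatedSum≡iteratedHarmonic : ∀ m {n N} → n ≤ N → truncatedSum N n m ≡ iteratedHarmonic m n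
truncatedSum≡iteratedHarmonic zero    n≤N = refl
truncatedSum≡iteratedHarmonic (suc m) {n} {N} n≤N = begin
  truncatedSum N n (suc m)
    ≡⟨ ∑-cartesianProductWith _∷_ [1⋯ N ] (tuples [1⋯ N ] m) _ ⟩
  ∑[ k ∈ [1⋯ N ] ] ∑[ ks ∈ tuples [1⋯ N ] m ] (if k ℕ.+ Vec.sum ks ≤ᵇ n then weight (k ∷ ks) else 0ℚ)
    ≡⟨ ∑-cong [1⋯ N ] (truncatedSum-head N n m) ⟩
  ∑[ k ∈ [1⋯ N ] ] (if k ≤ᵇ n then reciprocal k * truncatedSum N (n ∸ k) m else 0ℚ)
    ≡⟨ ∑-cong [1⋯ N ] (λ k → cong (λ x → if k ≤ᵇ n then reciprocal k * x else 0ℚ)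
         (truncatedSum≡iteratedHarmonic m (ℕ.≤-trans (ℕ.m∸n≤m n k) n≤N))) ⟩
  ∑[ k ∈ [1⋯ N ] ] term k
    -- A term for `k = 0` is adjoined to reach the range `[0⋯ N ]`; it vanishes because
    -- `reciprocal 0` is `0ℚ`.
    ≡⟨ +-identityˡ _ ⟨
  0ℚ + ∑[ k ∈ [1⋯ N ] ] term k
    ≡⟨ cong (_+ ∑ [1⋯ N ] term) (*-zeroˡ (iteratedHarmonic m n)) ⟨
  ∑[ k ∈ [0⋯ N ] ] term k
    ≡⟨ ∑-truncated≡⋆ reciprocal (iteratedHarmonic m) n≤N ⟩
  (reciprocal ⋆ iteratedHarmonic m) n ∎
  where
  term : ℕ → ℚ
  term k = if k ≤ᵇ n then reciprocal k * iteratedHarmonic m (n ∸ k) else 0ℚ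

-- The condition 1 ≤ sum may be dropped: a nonempty tuple with sum 0 has
-- product 0, and reciprocal 0 = 0.
multiHarmonic≡iteratedHarmonic : ∀ m n → multiHarmonic n m ≡ iteratedHarmonic m n
multiHarmonic≡iteratedHarmonic zero    n = refl
multiHarmonic≡iteratedHarmonic (suc m) n = begin
  multiHarmonic n (suc m)
    ≡⟨ ∑-filter _ (tuples [1⋯ n ] (suc m)) weight ⟩
  ∑[ ks ∈ tuples [1⋯ n ] (suc m) ] (if (1 ≤ᵇ Vec.sum ks) ∧ (Vec.sum ks ≤ᵇ n) then weight ks else 0ℚ)
    ≡⟨ ∑-cong (tuples [1⋯ n ] (suc m)) positive ⟩
  truncatedSum n n (suc m)
    ≡⟨ truncatedSum≡iteratedHarmonic (suc m) (ℕ.≤-refl {n}) ⟩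
  iteratedHarmonic (suc m) n ∎
  where
  positive : (ks : Vec ℕ (suc m)) →
    (if (1 ≤ᵇ Vec.sum ks) ∧ (Vec.sum ks ≤ᵇ n) then weight ks else 0ℚ)
      ≡ (if Vec.sum ks ≤ᵇ n then weight ks else 0ℚ)
  positive (zero  ∷ ks) = trans
    (if-eta ((1 ≤ᵇ Vec.sum ks) ∧ (Vec.sum ks ≤ᵇ n))) (sym (if-eta (Vec.sum ks ≤ᵇ n)))
  positive (suc k ∷ ks) = refl

multiHarmonic-suc : ∀ m n → multiHarmonic n (suc m) ≡ (reciprocal ⋆ (λ k → multiHarmonic k m)) n
multiHarmonic-suc m n = trans
  (multiHarmonic≡iteratedHarmonic (suc m) n)
  (sym (⋆-congˡ reciprocal (multiHarmonic≡iteratedHarmonic m) n))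

multiHarmonic-1 : ∀ n → multiHarmonic n 1 ≡ harmonic n
multiHarmonic-1 n = trans (multiHarmonic-suc 0 n) (sym (harmonic≡⋆ n))

multiHarmonic-2 : ∀ n → multiHarmonic n 2 ≡ harmonic n * harmonic n - harmonic⁽ 2 ⁾ n
multiHarmonic-2 n = begin
  multiHarmonic n 2                           ≡⟨ multiHarmonic-suc 1 n ⟩
  (reciprocal ⋆ (λ k → multiHarmonic k 1)) n  ≡⟨ ⋆-congˡ reciprocal multiHarmonic-1 n ⟩
  (reciprocal ⋆ harmonic) n                   ≡⟨ reciprocal-⋆-harmonic n ⟩
  harmonic n * harmonic n - harmonic⁽ 2 ⁾ n   ∎

-- Binomial coefficients

-- The absorption identity, by induction: Pascal's rule splits the left side, one copy of `c₁` is
-- set aside, and the induction hypotheses for `k` and `suc k` recombine by Pascal's rule into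
-- `suc n ℕ.* c₁`.
[k+1]*[n+1]C[k+1]≡[n+1]*nCk : ∀ n k → suc k ℕ.* (suc n C suc k) ≡ suc n ℕ.* (n C k)
[k+1]*[n+1]C[k+1]≡[n+1]*nCk n zero =
  trans (ℕ.*-identityˡ _) (trans (nC1≡n (suc n)) (sym (ℕ.*-identityʳ (suc n))))
[k+1]*[n+1]C[k+1]≡[n+1]*nCk zero (suc k) =
  trans (cong (suc (suc k) ℕ.*_) (k>n⇒nCk≡0 {1} {suc (suc k)} (s≤s (s≤s z≤n)))) (ℕ.*-zeroʳ (suc (suc k)))
[k+1]*[n+1]C[k+1]≡[n+1]*nCk (suc n) (suc k) = begin
  suc (suc k) ℕ.* (suc (suc n) C suc (suc k))
    ≡⟨ cong (suc (suc k) ℕ.*_) (nCk+nC[k+1]≡[n+1]C[k+1] (suc n) (suc k)) ⟨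
  suc (suc k) ℕ.* (c₁ ℕ.+ c₂)
    ≡⟨ expand k c₁ c₂ ⟩
  c₁ ℕ.+ (suc k ℕ.* c₁ ℕ.+ suc (suc k) ℕ.* c₂)
    ≡⟨ cong (c₁ ℕ.+_) (cong₂ ℕ._+_ ([k+1]*[n+1]C[k+1]≡[n+1]*nCk n k)
                                   ([k+1]*[n+1]C[k+1]≡[n+1]*nCk n (suc k))) ⟩
  c₁ ℕ.+ (suc n ℕ.* (n C k) ℕ.+ suc n ℕ.* (n C suc k))
    ≡⟨ cong (c₁ ℕ.+_) (ℕ.*-distribˡ-+ (suc n) (n C k) (n C suc k)) ⟨
  c₁ ℕ.+ suc n ℕ.* (n C k ℕ.+ n C suc k)
    ≡⟨ cong (λ c → c₁ ℕ.+ suc n ℕ.* c) (nCk+nC[k+1]≡[n+1]C[k+1] n k) ⟩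
  suc (suc n) ℕ.* c₁ ∎
  where
  c₁ c₂ : ℕ
  c₁ = suc n C suc k
  c₂ = suc n C suc (suc k)
  expand : ∀ k a b → suc (suc k) ℕ.* (a ℕ.+ b) ≡ a ℕ.+ (suc k ℕ.* a ℕ.+ suc (suc k) ℕ.* b)
  expand = ℕ.solve-∀

-- The coefficients of 1 / (1 - z)ᵖ⁺¹.
shiftedBinomial : ℕ → ℕ → ℚ
shiftedBinomial p k = binomial (k ℕ.+ p) k

shiftedBinomial-pascal : ∀ p k →
  shiftedBinomial (suc p) (suc k) ≡ shiftedBinomial (suc p) k + shiftedBinomial p (suc k)
shiftedBinomial-pascal p k = begin
  fromℕ (suc (k ℕ.+ suc p) C suc k)
    ≡⟨ cong fromℕ (nCk+nC[k+1]≡[n+1]C[k+1] (k ℕ.+ suc p) k) ⟨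
  fromℕ ((k ℕ.+ suc p) C k ℕ.+ (k ℕ.+ suc p) C suc k)
    ≡⟨ fromℕ-homo-+ ((k ℕ.+ suc p) C k) ((k ℕ.+ suc p) C suc k) ⟩
  shiftedBinomial (suc p) k + binomial (k ℕ.+ suc p) (suc k)
    ≡⟨ cong (λ n → shiftedBinomial (suc p) k + binomial n (suc k)) (ℕ.+-suc k p) ⟩
  shiftedBinomial (suc p) k + shiftedBinomial p (suc k) ∎

-- Write `P` as `N − K`: absorption turns `K * x` into `N * y`, and Pascal's rule `x = y + z` leaves
-- `N * z`.
shiftedBinomial-absorb : ∀ p k →
  fromℕ (suc p) * shiftedBinomial (suc p) (suc k)
    ≡ fromℕ (suc k ℕ.+ suc p) * shiftedBinomial p (suc k)
shiftedBinomial-absorb p k = begin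
  P * x                      ≡⟨ solve 3 (λ K P x → P :* x := (K :+ P) :* x :- K :* x) refl K P x ⟩
  (K + P) * x - K * x        ≡⟨ cong₂ (λ a b → a * x - b) (sym (fromℕ-homo-+ (suc k) (suc p))) absorb ⟩
  N * x - N * y              ≡⟨ cong (λ a → N * a - N * y) (shiftedBinomial-pascal p k) ⟩
  N * (y + z) - N * y        ≡⟨ solve 3 (λ N y z → N :* (y :+ z) :- N :* y := N :* z) refl N y z ⟩
  N * z                      ∎
  where
  P K N x y z : ℚ
  P = fromℕ (suc p)
  K = fromℕ (suc k)
  N = fromℕ (suc k ℕ.+ suc p)
  x = shiftedBinomial (suc p) (suc k)
  y = shiftedBinomial (suc p) k
  z = shiftedBinomial p (suc k)
  absorb : K * x ≡ N * y
  absorb = begin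
    K * x
      ≡⟨ fromℕ-homo-* (suc k) (suc (k ℕ.+ suc p) C suc k) ⟨
    fromℕ (suc k ℕ.* (suc (k ℕ.+ suc p) C suc k))
      ≡⟨ cong fromℕ ([k+1]*[n+1]C[k+1]≡[n+1]*nCk (k ℕ.+ suc p) k) ⟩
    fromℕ (suc (k ℕ.+ suc p) ℕ.* ((k ℕ.+ suc p) C k))
      ≡⟨ fromℕ-homo-* (suc (k ℕ.+ suc p)) ((k ℕ.+ suc p) C k) ⟩
    N * y ∎

-- The previous identity divided by `N * P`. It trades the last summand of the upper harmonic number
-- for the last summand of the lower one.
shiftedBinomial-reciprocal : ∀ p k →
  shiftedBinomial (suc p) (suc k) * reciprocal (suc k ℕ.+ suc p)
    ≡ shiftedBinomial p (suc k) * reciprocal (suc p)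
shiftedBinomial-reciprocal p k = begin
  x * N⁻¹                ≡⟨ *-identityˡ _ ⟨
  1ℚ * (x * N⁻¹)         ≡⟨ cong (_* (x * N⁻¹)) (reciprocal-inverse p) ⟨
  P * P⁻¹ * (x * N⁻¹)    ≡⟨ solve 4 (λ P P⁻¹ x N⁻¹ → P :* P⁻¹ :* (x :* N⁻¹) := P :* x :* (P⁻¹ :* N⁻¹)) refl P P⁻¹ x N⁻¹ ⟩
  P * x * (P⁻¹ * N⁻¹)    ≡⟨ cong (_* (P⁻¹ * N⁻¹)) (shiftedBinomial-absorb p k) ⟩
  N * z * (P⁻¹ * N⁻¹)    ≡⟨ solve 4 (λ N N⁻¹ P⁻¹ z → N :* z :* (P⁻¹ :* N⁻¹) := N :* N⁻¹ :* (z :* P⁻¹)) refl N N⁻¹ P⁻¹ z ⟩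
  N * N⁻¹ * (z * P⁻¹)    ≡⟨ cong (_* (z * P⁻¹)) (reciprocal-inverse (k ℕ.+ suc p)) ⟩
  1ℚ * (z * P⁻¹)         ≡⟨ *-identityˡ _ ⟩
  z * P⁻¹                ∎
  where
  P P⁻¹ N N⁻¹ x z : ℚ
  P   = fromℕ (suc p)
  P⁻¹ = reciprocal (suc p)
  N   = fromℕ (suc k ℕ.+ suc p)
  N⁻¹ = reciprocal (suc k ℕ.+ suc p)
  x   = shiftedBinomial (suc p) (suc k)
  z   = shiftedBinomial p (suc k)

shiftedBinomial-zero : ∀ k → shiftedBinomial 0 k ≡ 1ℚ
shiftedBinomial-zero k =
  cong fromℕ (trans (cong (_C k) (ℕ.+-identityʳ k)) (nCn≡1 k))

harmonicBinomial : ℕ → ℕ → ℚ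
harmonicBinomial p k = shiftedBinomial p k * (harmonic (k ℕ.+ p) - harmonic p)

-- The same recurrence as `shiftedBinomial-pascal`. The increment `x * N⁻¹` equals `z * P⁻¹`,
-- exactly what changes `harmonic (suc p)` into `harmonic p` in the part belonging to `z`.
harmonicBinomial-suc : ∀ p k →
  harmonicBinomial (suc p) (suc k) ≡ harmonicBinomial (suc p) k + harmonicBinomial p (suc k)
harmonicBinomial-suc p k = begin
  x * (harmonic (suc (k ℕ.+ suc p)) - harmonic (suc p))
    ≡⟨ cong₂ (λ a b → x * (a - b)) (harmonic-suc (k ℕ.+ suc p)) (harmonic-suc p) ⟩
  x * (h + N⁻¹ - (g + P⁻¹))
    ≡⟨ solve 5 (λ x h N⁻¹ g P⁻¹ → x :* (h :+ N⁻¹ :- (g :+ P⁻¹))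
                               := x :* (h :- (g :+ P⁻¹)) :+ x :* N⁻¹) refl x h N⁻¹ g P⁻¹ ⟩
  x * (h - (g + P⁻¹)) + x * N⁻¹
    ≡⟨ cong₂ (λ a b → a * (h - (g + P⁻¹)) + b)
         (shiftedBinomial-pascal p k) (shiftedBinomial-reciprocal p k) ⟩
  (y + z) * (h - (g + P⁻¹)) + z * P⁻¹
    ≡⟨ solve 5 (λ y z h g P⁻¹ → (y :+ z) :* (h :- (g :+ P⁻¹)) :+ z :* P⁻¹
                             := y :* (h :- (g :+ P⁻¹)) :+ z :* (h :- g)) refl y z h g P⁻¹ ⟩
  y * (h - (g + P⁻¹)) + z * (h - g)
    ≡⟨ cong₂ (λ a n → y * (h - a) + z * (harmonic n - g)) (sym (harmonic-suc p)) (ℕ.+-suc k p) ⟩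
  harmonicBinomial (suc p) k + harmonicBinomial p (suc k) ∎
  where
  x y z h g N⁻¹ P⁻¹ : ℚ
  x   = shiftedBinomial (suc p) (suc k)
  y   = shiftedBinomial (suc p) k
  z   = shiftedBinomial p (suc k)
  h   = harmonic (k ℕ.+ suc p)
  g   = harmonic p
  N⁻¹ = reciprocal (suc k ℕ.+ suc p)
  P⁻¹ = reciprocal (suc p)

-- Both sides satisfy the same Pascal-type recurrence in `p` and `k`. On the boundary, `p = 0` gives
-- the harmonic numbers and `k = 0` gives zero.
harmonicBinomial≡⋆ : ∀ p k → harmonicBinomial p k ≡ (reciprocal ⋆ shiftedBinomial p) k
harmonicBinomial≡⋆ zero k = begin
  shiftedBinomial 0 k * (harmonic (k ℕ.+ 0) - 0ℚ)
    ≡⟨ cong₂ (λ a n → a * (harmonic n - 0ℚ)) (shiftedBinomial-zero k) (ℕ.+-identityʳ k) ⟩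
  1ℚ * (harmonic k - 0ℚ)
    ≡⟨ solve 1 (λ h → con 1ℚ :* (h :- con 0ℚ) := h) refl (harmonic k) ⟩
  harmonic k
    ≡⟨ harmonic≡⋆ k ⟩
  (reciprocal ⋆ const 1ℚ) k
    ≡⟨ ⋆-congˡ reciprocal shiftedBinomial-zero k ⟨
  (reciprocal ⋆ shiftedBinomial 0) k ∎
harmonicBinomial≡⋆ (suc p) zero = begin
  b * (harmonic (suc p) - harmonic (suc p))
    ≡⟨ solve 2 (λ b h → b :* (h :- h) := con 0ℚ :* b) refl b (harmonic (suc p)) ⟩
  0ℚ * b ∎
  where
  b : ℚ
  b = shiftedBinomial (suc p) 0
harmonicBinomial≡⋆ (suc p) (suc k) = begin
  harmonicBinomial (suc p) (suc k)
    ≡⟨ harmonicBinomial-suc p k ⟩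
  harmonicBinomial (suc p) k + harmonicBinomial p (suc k)
    ≡⟨ cong₂ _+_ (harmonicBinomial≡⋆ (suc p) k) (harmonicBinomial≡⋆ p (suc k)) ⟩
  (reciprocal ⋆ shiftedBinomial (suc p)) k + (reciprocal ⋆ shiftedBinomial p) (suc k)
    ≡⟨ cong ((reciprocal ⋆ shiftedBinomial (suc p)) k +_) (⋆-sucʳ reciprocal (shiftedBinomial p) k) ⟩
  (reciprocal ⋆ shiftedBinomial (suc p)) k + (r + (reciprocal ⋆ shiftedBinomial p ∘ suc) k)
    ≡⟨ solve 3 (λ a b c → a :+ (b :+ c) := b :+ (a :+ c)) refl
         ((reciprocal ⋆ shiftedBinomial (suc p)) k) r ((reciprocal ⋆ shiftedBinomial p ∘ suc) k) ⟩
  r + ((reciprocal ⋆ shiftedBinomial (suc p)) k + (reciprocal ⋆ shiftedBinomial p ∘ suc) k)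
    ≡⟨ cong (r +_) (⋆-distribˡ-+ reciprocal (shiftedBinomial (suc p)) (shiftedBinomial p ∘ suc) k) ⟨
  r + (reciprocal ⋆ (λ j → shiftedBinomial (suc p) j + shiftedBinomial p (suc j))) k
    ≡⟨ cong (r +_) (⋆-congˡ reciprocal (shiftedBinomial-pascal p) k) ⟨
  r + (reciprocal ⋆ shiftedBinomial (suc p) ∘ suc) k
    ≡⟨ ⋆-sucʳ reciprocal (shiftedBinomial (suc p)) k ⟨
  (reciprocal ⋆ shiftedBinomial (suc p)) (suc k) ∎
  where
  r : ℚ
  -- `shiftedBinomial p 0` is `1ℚ` for every `p`, so the same `r` is the split-off term for both `p`
  -- and `suc p`.
  r = reciprocal (suc k) * 1ℚ

-- The convolution identity and its special cases

∑-binomial-multiHarmonic : ∀ n p m →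
  ∑[ k ∈ [0⋯ n ] ] (binomial (k ℕ.+ p) k * multiHarmonic (n ∸ k) m * (harmonic (k ℕ.+ p) - harmonic p))
    ≡ ∑[ k ∈ [0⋯ n ] ] (binomial (k ℕ.+ p) k * multiHarmonic (n ∸ k) (suc m))
∑-binomial-multiHarmonic n p m = begin
  ∑[ k ∈ [0⋯ n ] ] (B k * H (n ∸ k) * (harmonic (k ℕ.+ p) - harmonic p))
    ≡⟨ ∑-cong [0⋯ n ] (λ k → solve 3 (λ b h d → b :* h :* d := b :* d :* h) refl
         (B k) (H (n ∸ k)) (harmonic (k ℕ.+ p) - harmonic p)) ⟩
  ∑[ k ∈ [0⋯ n ] ] (harmonicBinomial p k * H (n ∸ k))
    ≡⟨ ∑≡⋆ (harmonicBinomial p) H n ⟩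
  (harmonicBinomial p ⋆ H) n
    -- Commuting the factors puts `reciprocal` next to `H`, where it raises `m` by one.
    ≡⟨ ⋆-congʳ H (λ k → trans (harmonicBinomial≡⋆ p k) (⋆-comm reciprocal B k)) n ⟩
  ((B ⋆ reciprocal) ⋆ H) n
    ≡⟨ ⋆-assoc B reciprocal H n ⟩
  (B ⋆ (reciprocal ⋆ H)) n
    ≡⟨ ⋆-congˡ B (multiHarmonic-suc m) n ⟨
  (B ⋆ (λ k → multiHarmonic k (suc m))) n
    ≡⟨ ∑≡⋆ B (λ k → multiHarmonic k (suc m)) n ⟨
  ∑[ k ∈ [0⋯ n ] ] (B k * multiHarmonic (n ∸ k) (suc m)) ∎
  where
  B H : ℕ → ℚ
  B = shiftedBinomial p
  H k = multiHarmonic k m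

theorem10 : (∀ (n p m : ℕ) →
    ∑[ k ∈ [0⋯ n ] ] (binomial (k ℕ.+ p) k * multiHarmonic (n ∸ k) m * (harmonic (k ℕ.+ p) - harmonic p))
    ≡ ∑[ k ∈ [0⋯ n ] ] (binomial (k ℕ.+ p) k * multiHarmonic (n ∸ k) (suc m)))
    × (∀ (n p : ℕ) →
    ∑[ k ∈ [0⋯ n ] ] (binomial (k ℕ.+ p) k * (harmonic (k ℕ.+ p) - harmonic p))
    ≡ ∑[ k ∈ [0⋯ n ] ] (binomial (k ℕ.+ p) k * harmonic (n ∸ k)))
    × (∀ (n p : ℕ) →
    ∑[ k ∈ [0⋯ n ] ] (binomial (k ℕ.+ p) k * harmonic (n ∸ k) * (harmonic (k ℕ.+ p) - harmonic p))
    ≡ ∑[ k ∈ [0⋯ n ] ] (binomial (k ℕ.+ p) k * (harmonic (n ∸ k) * harmonic (n ∸ k) - harmonic⁽ 2 ⁾ (n ∸ k))))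
theorem10 = ∑-binomial-multiHarmonic , case-0 , case-1
  where
  case-0 : ∀ n p →
    ∑[ k ∈ [0⋯ n ] ] (binomial (k ℕ.+ p) k * (harmonic (k ℕ.+ p) - harmonic p))
    ≡ ∑[ k ∈ [0⋯ n ] ] (binomial (k ℕ.+ p) k * harmonic (n ∸ k))
  case-0 n p = begin
    ∑[ k ∈ [0⋯ n ] ] (binomial (k ℕ.+ p) k * (harmonic (k ℕ.+ p) - harmonic p))
      -- The inserted factor `1ℚ` is `multiHarmonic (n ∸ k) 0` by definition.
      ≡⟨ ∑-cong [0⋯ n ] (λ k → cong (_* (harmonic (k ℕ.+ p) - harmonic p)) (*-identityʳ (binomial (k ℕ.+ p) k))) ⟨
    ∑[ k ∈ [0⋯ n ] ] (binomial (k ℕ.+ p) k * 1ℚ * (harmonic (k ℕ.+ p) - harmonic p))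
      ≡⟨ ∑-binomial-multiHarmonic n p 0 ⟩
    ∑[ k ∈ [0⋯ n ] ] (binomial (k ℕ.+ p) k * multiHarmonic (n ∸ k) 1)
      ≡⟨ ∑-cong [0⋯ n ] (λ k → cong (binomial (k ℕ.+ p) k *_) (multiHarmonic-1 (n ∸ k))) ⟩
    ∑[ k ∈ [0⋯ n ] ] (binomial (k ℕ.+ p) k * harmonic (n ∸ k)) ∎

  case-1 : ∀ n p →
    ∑[ k ∈ [0⋯ n ] ] (binomial (k ℕ.+ p) k * harmonic (n ∸ k) * (harmonic (k ℕ.+ p) - harmonic p))
    ≡ ∑[ k ∈ [0⋯ n ] ] (binomial (k ℕ.+ p) k * (harmonic (n ∸ k) * harmonic (n ∸ k) - harmonic⁽ 2 ⁾ (n ∸ k)))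
  case-1 n p = begin
    ∑[ k ∈ [0⋯ n ] ] (binomial (k ℕ.+ p) k * harmonic (n ∸ k) * (harmonic (k ℕ.+ p) - harmonic p))
      ≡⟨ ∑-cong [0⋯ n ] (λ k → cong (λ h → binomial (k ℕ.+ p) k * h * (harmonic (k ℕ.+ p) - harmonic p))
           (multiHarmonic-1 (n ∸ k))) ⟨
    ∑[ k ∈ [0⋯ n ] ] (binomial (k ℕ.+ p) k * multiHarmonic (n ∸ k) 1 * (harmonic (k ℕ.+ p) - harmonic p))
      ≡⟨ ∑-binomial-multiHarmonic n p 1 ⟩
    ∑[ k ∈ [0⋯ n ] ] (binomial (k ℕ.+ p) k * multiHarmonic (n ∸ k) 2)
      ≡⟨ ∑-cong [0⋯ n ] (λ k → cong (binomial (k ℕ.+ p) k *_) (multiHarmonic-2 (n ∸ k))) ⟩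
    ∑[ k ∈ [0⋯ n ] ] (binomial (k ℕ.+ p) k * (harmonic (n ∸ k) * harmonic (n ∸ k) - harmonic⁽ 2 ⁾ (n ∸ k))) ∎
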